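{- Let $m,s$ be integers with $0\le s<m$. Define \[ R_1(x;m,s)=L_{2s+1}(x)L_{2s+3}(x)\cdots L_{2m+1}(x),\qquad R_2(x;m,s)=\sum_{k=s}^{m}\frac{1+2k}{1+2s}\binom{2m+1}{m-k}\binom{k+s}{2s}\frac{1}{L_{2k+1}(x)}, \] and $R(x;m,s)=R_1(x;m,s)R_2(x;m,s)$. Then $(x^2+4)^{m-s}$ divides $R(x;m,s)$, and the quotient $R(x;m,s)/(x^2+4)^{m-s}$ is a polynomial with integer coefficients.
   Context: The Lucas polynomials are $L_n(x)=\alpha(x)^n+\beta(x)^n$ where $\alpha(x)=\frac{x+\sqrt{x^2+4}}{2}$, $\beta(x)=\frac{x-\sqrt{x^2+4}}{2}$; equivalently $L_0(x)=2$, $L_1(x)=x$, $L_n(x)=xL_{n-1}(x)+L_{n-2}(x)$ for all integers $n$. -}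

module Defs where

open import Data.Nat as ℕ using (ℕ; zero; suc; _∸_; _≟_)
open import Data.Nat.Combinatorics using (_C_)
open import Data.Integer as ℤ using (ℤ; +_)
open import Data.List using (List; []; _∷_; map; foldr; filter; upTo)
open import Relation.Binary.PropositionalEquality using (_≡_)
open import Relation.Nullary using (¬?)

-- Polynomials with integer coefficients, as coefficient lists,
-- lowest degree first (trailing zeros allowed).
Poly : Set
Poly = List ℤ

coeff : Poly → ℕ → ℤ
coeff []       _       = + 0
coeff (a ∷ p)  zero    = a
coeff (a ∷ p)  (suc i) = coeff p i

infix 4 _≈P_
_≈P_ : Poly → Poly → Set
p ≈P q = ∀ i → coeff p i ≡ coeff q i

infixl 6 _+P_
_+P_ : Poly → Poly → Poly
[]      +P q       = q
(a ∷ p) +P []      = a ∷ p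
(a ∷ p) +P (b ∷ q) = (a ℤ.+ b) ∷ (p +P q)

scaleP : ℤ → Poly → Poly
scaleP c p = map (c ℤ.*_) p

infixl 7 _*P_
_*P_ : Poly → Poly → Poly
[]      *P q = []
(a ∷ p) *P q = scaleP a q +P (+ 0 ∷ (p *P q))

constP : ℤ → Poly
constP c = c ∷ []

X : Poly
X = + 0 ∷ + 1 ∷ []

powP : Poly → ℕ → Poly
powP p zero    = constP (+ 1)
powP p (suc n) = p *P powP p n

lucas : ℕ → Poly
lucas zero          = constP (+ 2)
lucas (suc zero)    = X
lucas (suc (suc n)) = X *P lucas (suc n) +P lucas n

sumP : List Poly → Poly
sumP = foldr _+P_ []

prodP : List Poly → Poly
prodP = foldr _*P_ (constP (+ 1))

range : ℕ → ℕ → List ℕ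
range s m = map (s ℕ.+_) (upTo (suc (m ∸ s)))

x²+4 : Poly
x²+4 = X *P X +P constP (+ 4)

R₁ : ℕ → ℕ → Poly
R₁ m s = prodP (map (λ j → lucas (suc (2 ℕ.* j))) (range s m))

-- R₁(x;m,s) / L_{2k+1}(x) for s ≤ k ≤ m, i.e. the product with the
-- factor L_{2k+1} omitted
R₁-without : ℕ → ℕ → ℕ → Poly
R₁-without m s k =
  prodP (map (λ j → lucas (suc (2 ℕ.* j))) (filter (λ j → ¬? (j ≟ k)) (range s m)))

-- (1+2s) · R(x;m,s) = (1+2s) · R₁ · R₂
--   = Σ_{k=s}^{m} (1+2k) C(2m+1, m-k) C(k+s, 2s) · R₁ / L_{2k+1}
-- a polynomial with integer coefficients.
scaledR : ℕ → ℕ → Poly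
scaledR m s = sumP (map (λ k →
  scaleP (+ ((1 ℕ.+ 2 ℕ.* k) ℕ.* ((1 ℕ.+ 2 ℕ.* m) C (m ∸ k)) ℕ.* ((k ℕ.+ s) C (2 ℕ.* s))))
         (R₁-without m s k)) (range s m))

{-# OPTIONS --safe #-}

-- Write y = x²+4 and L_{2k+1} = (-1)^k x N_k.  The N_k satisfy N_{k+1} - 2N_k + N_{k-1} = -y N_k and
-- N_{-1-k} = N_k, so the n-th differences of k ↦ N_k on ℤ are divisible by y^⌈n/2⌉.  By the Leibniz
-- rule functions with this property form a ring; it contains the inverse of N_k modulo any power
-- of y (a geometric series, as N_k ≡ 1 mod y) and y^(s+1) b_k, where b_k = (2k+1)/(2s+1) C(k+s,2s) has
-- degree 2s+1 in k.  The (2m+1)-st difference at -1-m of the product of these two is, the product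
-- being odd under k ↦ -1-k, equal to 2 y^(s+1) Σ_k ± C(2m+1,m-k) b_k / N_k, and it is divisible
-- by y^(m+1).  Multiplying by R₁ and cancelling y^(s+1) and the factors 2 and x, both coprime to y,
-- gives the claim.

module Submission where

open import Defs
open import Algebra.Bundles using (CommutativeRing)
import Algebra.Definitions.RawMagma as RawMagmaDefinitions
import Algebra.Properties.CommutativeSemigroup.Divisibility as CommutativeSemigroupDivisibility
import Algebra.Properties.Semiring.Divisibility as SemiringDivisibility
open import Data.Integer as ℤ using (ℤ; +_; -[1+_])
import Data.Integer.Properties as ℤ
import Data.Integer.Tactic.RingSolver as ℤ-Solver
open import Data.List using ([]; _∷_; applyUpTo; upTo; map; filter; drop)
open import Data.List.Membership.Propositional using (_∈_)
open import Data.List.Membership.Propositional.Properties using (∈-map⁺; ∈-upTo⁺)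
open import Data.List.Properties using (map-∘; map-upTo; filter-all; filter-accept; filter-reject)
open import Data.List.Relation.Unary.All as All using ()
open import Data.List.Relation.Unary.AllPairs using (_∷_)
open import Data.List.Relation.Unary.Any using (here; there)
open import Data.List.Relation.Unary.Unique.Propositional using (Unique)
open import Data.List.Relation.Unary.Unique.Propositional.Properties using (map⁺; upTo⁺)
open import Data.Maybe using (Maybe; just; nothing)
open import Data.Nat as ℕ using (ℕ; zero; suc; _<_; _≤_; z≤n; s≤s; _∸_; _+_; _*_; _≟_)
open import Data.Nat.Combinatorics using (_C_; nCk+nC[k+1]≡[n+1]C[k+1]; k>n⇒nCk≡0; nCk≡nC[n∸k]; nC1≡n)
import Data.Nat.Properties as ℕ
import Data.Nat.Tactic.RingSolver as ℕ-Solver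
open import Data.Product using (Σ; _,_)
open import Function using (_∘_)
open import Level using (0ℓ)
open import Relation.Binary.PropositionalEquality as ≡ using (_≡_)
import Relation.Binary.Reasoning.Setoid as SetoidReasoning
open import Relation.Nullary using (¬?)
open import Tactic.RingSolver using (solve-∀)
open import Tactic.RingSolver.Core.AlmostCommutativeRing using (AlmostCommutativeRing; fromCommutativeRing)

-- The ring of integer polynomials

-- Wrapped in a record so that p and q can be inferred from p ≋ q.
infix 4 _≋_
record _≋_ (p q : Poly) : Set where
  constructor coeffwise
  field coeffs : p ≈P q
open _≋_

infix 8 -P_
-P_ : Poly → Poly
-P p = scaleP (ℤ.- (+ 1)) p

coeff-+P : ∀ p q i → coeff (p +P q) i ≡ coeff p i ℤ.+ coeff q i
coeff-+P []      q       i       = ≡.sym (ℤ.+-identityˡ (coeff q i))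
coeff-+P (a ∷ p) []      i       = ≡.sym (ℤ.+-identityʳ (coeff (a ∷ p) i))
coeff-+P (a ∷ p) (b ∷ q) zero    = ≡.refl
coeff-+P (a ∷ p) (b ∷ q) (suc i) = coeff-+P p q i

coeff-scaleP : ∀ c p i → coeff (scaleP c p) i ≡ c ℤ.* coeff p i
coeff-scaleP c []      i       = ≡.sym (ℤ.*-zeroʳ c)
coeff-scaleP c (a ∷ p) zero    = ≡.refl
coeff-scaleP c (a ∷ p) (suc i) = coeff-scaleP c p i

≋-refl : ∀ {p} → p ≋ p
≋-refl = coeffwise λ _ → ≡.refl

≋-sym : ∀ {p q} → p ≋ q → q ≋ p
≋-sym (coeffwise e) = coeffwise λ i → ≡.sym (e i)

≋-trans : ∀ {p q r} → p ≋ q → q ≋ r → p ≋ r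
≋-trans (coeffwise e) (coeffwise f) = coeffwise λ i → ≡.trans (e i) (f i)

+P-cong : ∀ {p p′ q q′} → p ≋ p′ → q ≋ q′ → p +P q ≋ p′ +P q′
+P-cong {p} {p′} {q} {q′} (coeffwise e) (coeffwise f) = coeffwise λ i →
  ≡.trans (coeff-+P p q i) (≡.trans (≡.cong₂ ℤ._+_ (e i) (f i)) (≡.sym (coeff-+P p′ q′ i)))

+P-comm : ∀ p q → p +P q ≋ q +P p
+P-comm p q = coeffwise λ i →
  ≡.trans (coeff-+P p q i) (≡.trans (ℤ.+-comm (coeff p i) _) (≡.sym (coeff-+P q p i)))

+P-assoc : ∀ p q r → (p +P q) +P r ≋ p +P (q +P r)
+P-assoc p q r = coeffwise λ i →
  ≡.trans (coeff-+P (p +P q) r i) (≡.trans (≡.cong (ℤ._+ coeff r i) (coeff-+P p q i))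
  (≡.trans (ℤ.+-assoc (coeff p i) _ _) (≡.sym
  (≡.trans (coeff-+P p (q +P r) i) (≡.cong (λ c → coeff p i ℤ.+ c) (coeff-+P q r i))))))

+P-identityʳ : ∀ p → p +P [] ≋ p
+P-identityʳ p = +P-comm p []

scaleP-cong : ∀ c {p q} → p ≋ q → scaleP c p ≋ scaleP c q
scaleP-cong c {p} {q} (coeffwise e) = coeffwise λ i →
  ≡.trans (coeff-scaleP c p i) (≡.trans (≡.cong (c ℤ.*_) (e i)) (≡.sym (coeff-scaleP c q i)))

scaleP-distribˡ : ∀ c p q → scaleP c (p +P q) ≋ scaleP c p +P scaleP c q
scaleP-distribˡ c p q = coeffwise λ i →
  ≡.trans (coeff-scaleP c (p +P q) i) (≡.trans (≡.cong (c ℤ.*_) (coeff-+P p q i))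
  (≡.trans (ℤ.*-distribˡ-+ c (coeff p i) _) (≡.sym
  (≡.trans (coeff-+P (scaleP c p) _ i) (≡.cong₂ ℤ._+_ (coeff-scaleP c p i) (coeff-scaleP c q i))))))

scaleP-distribʳ : ∀ c d p → scaleP (c ℤ.+ d) p ≋ scaleP c p +P scaleP d p
scaleP-distribʳ c d p = coeffwise λ i →
  ≡.trans (coeff-scaleP (c ℤ.+ d) p i) (≡.trans (ℤ.*-distribʳ-+ (coeff p i) c d) (≡.sym
  (≡.trans (coeff-+P (scaleP c p) _ i) (≡.cong₂ ℤ._+_ (coeff-scaleP c p i) (coeff-scaleP d p i)))))

scaleP-assoc : ∀ c d p → scaleP (c ℤ.* d) p ≋ scaleP c (scaleP d p)
scaleP-assoc c d p = coeffwise λ i →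
  ≡.trans (coeff-scaleP (c ℤ.* d) p i) (≡.trans (ℤ.*-assoc c d (coeff p i)) (≡.sym
  (≡.trans (coeff-scaleP c (scaleP d p) i) (≡.cong (c ℤ.*_) (coeff-scaleP d p i)))))

scaleP-1 : ∀ p → scaleP (+ 1) p ≋ p
scaleP-1 p = coeffwise λ i → ≡.trans (coeff-scaleP (+ 1) p i) (ℤ.*-identityˡ (coeff p i))

scaleP-0 : ∀ p → scaleP (+ 0) p ≋ []
scaleP-0 p = coeffwise λ i → coeff-scaleP (+ 0) p i

-P-inverseʳ : ∀ p → p +P (-P p) ≋ []
-P-inverseʳ p = coeffwise λ i →
  ≡.trans (coeff-+P p (-P p) i) (≡.trans (≡.cong (λ c → coeff p i ℤ.+ c) (coeff-scaleP (ℤ.- (+ 1)) p i))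
  (≡.trans (≡.cong (λ c → coeff p i ℤ.+ c) (ℤ.-1*i≡-i (coeff p i))) (ℤ.+-inverseʳ (coeff p i))))

∷-cong : ∀ {a b p q} → a ≡ b → p ≋ q → a ∷ p ≋ b ∷ q
∷-cong a≡b (coeffwise e) = coeffwise λ { zero → a≡b ; (suc i) → e i }

0∷[] : + 0 ∷ [] ≋ []
0∷[] = coeffwise λ { zero → ≡.refl ; (suc i) → ≡.refl }

+P-congˡ : ∀ p {q r} → q ≋ r → p +P q ≋ p +P r
+P-congˡ p e = +P-cong {p} ≋-refl e

+P-congʳ : ∀ r {p q} → p ≋ q → p +P r ≋ q +P r
+P-congʳ r e = +P-cong {q = r} e ≋-refl

+P-leftComm : ∀ p q r → p +P (q +P r) ≋ q +P (p +P r)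
+P-leftComm p q r =
  ≋-trans (≋-sym (+P-assoc p q r)) (≋-trans (+P-congʳ r (+P-comm p q)) (+P-assoc q p r))

+P-interchange : ∀ p q r s → (p +P q) +P (r +P s) ≋ (p +P r) +P (q +P s)
+P-interchange p q r s =
  ≋-trans (+P-assoc p q _) (≋-trans (+P-congˡ p (+P-leftComm q r s)) (≋-sym (+P-assoc p r _)))

*P-congˡ : ∀ p {q r} → q ≋ r → p *P q ≋ p *P r
*P-congˡ []      e = ≋-refl
*P-congˡ (a ∷ p) e = +P-cong (scaleP-cong a e) (∷-cong ≡.refl (*P-congˡ p e))

*P-zeroʳ : ∀ p → p *P [] ≋ []
*P-zeroʳ []      = ≋-refl
*P-zeroʳ (a ∷ p) = ≋-trans (∷-cong ≡.refl (*P-zeroʳ p)) 0∷[]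

-- The mirror image of the defining recursion, which peels the left factor; with it commutativity is
-- a plain induction.
*P-∷ʳ : ∀ p b q → p *P (b ∷ q) ≋ scaleP b p +P (+ 0 ∷ p *P q)
*P-∷ʳ []      b q = ≋-sym 0∷[]
*P-∷ʳ (a ∷ p) b q = ∷-cong (≡.cong (ℤ._+ + 0) (ℤ.*-comm a b))
  (≋-trans (+P-congˡ (scaleP a q) (*P-∷ʳ p b q)) (+P-leftComm (scaleP a q) (scaleP b p) _))

*P-comm : ∀ p q → p *P q ≋ q *P p
*P-comm []      q = ≋-sym (*P-zeroʳ q)
*P-comm (a ∷ p) q = ≋-trans (+P-congˡ (scaleP a q) (∷-cong ≡.refl (*P-comm p q))) (≋-sym (*P-∷ʳ q a p))

-- Equal polynomials may be lists of different lengths, so congruence in the left factor is awkward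
-- by recursion on it; commutativity moves it to the right factor.
*P-cong : ∀ {p p′ q q′} → p ≋ p′ → q ≋ q′ → p *P q ≋ p′ *P q′
*P-cong {p} {p′} {q} {q′} e f =
  ≋-trans (*P-congˡ p f) (≋-trans (*P-comm p q′) (≋-trans (*P-congˡ q′ e) (*P-comm q′ p′)))

*P-distribʳ : ∀ r p q → (p +P q) *P r ≋ p *P r +P q *P r
*P-distribʳ r []      q       = ≋-refl
*P-distribʳ r (a ∷ p) []      = ≋-sym (+P-identityʳ _)
*P-distribʳ r (a ∷ p) (b ∷ q) =
  ≋-trans (+P-cong (scaleP-distribʳ a b r) (∷-cong ≡.refl (*P-distribʳ r p q)))
    (+P-interchange (scaleP a r) (scaleP b r) (+ 0 ∷ p *P r) (+ 0 ∷ q *P r))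

*P-distribˡ : ∀ r p q → r *P (p +P q) ≋ r *P p +P r *P q
*P-distribˡ r p q =
  ≋-trans (*P-comm r _) (≋-trans (*P-distribʳ r p q) (+P-cong (*P-comm p r) (*P-comm q r)))

scaleP-*P : ∀ c p q → scaleP c p *P q ≋ scaleP c (p *P q)
scaleP-*P c []      q = ≋-refl
scaleP-*P c (a ∷ p) q =
  ≋-trans (+P-cong (scaleP-assoc c a q) (∷-cong (≡.sym (ℤ.*-zeroʳ c)) (scaleP-*P c p q)))
    (≋-sym (scaleP-distribˡ c (scaleP a q) (+ 0 ∷ p *P q)))

0∷-*P : ∀ p q → (+ 0 ∷ p) *P q ≋ + 0 ∷ p *P q
0∷-*P p q = +P-congʳ (+ 0 ∷ p *P q) (scaleP-0 q)

*P-assoc : ∀ p q r → (p *P q) *P r ≋ p *P (q *P r)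
*P-assoc []      q r = ≋-refl
*P-assoc (a ∷ p) q r =
  ≋-trans (*P-distribʳ r (scaleP a q) (+ 0 ∷ p *P q))
    (+P-cong (scaleP-*P a q r) (≋-trans (0∷-*P (p *P q) r) (∷-cong ≡.refl (*P-assoc p q r))))

constP-* : ∀ c p → constP c *P p ≋ scaleP c p
constP-* c p = ≋-trans (+P-congˡ (scaleP c p) 0∷[]) (+P-identityʳ _)

*P-identityˡ : ∀ p → constP (+ 1) *P p ≋ p
*P-identityˡ p = ≋-trans (constP-* (+ 1) p) (scaleP-1 p)

polyRing : CommutativeRing 0ℓ 0ℓ
polyRing = record
  { Carrier = Poly ; _≈_ = _≋_ ; _+_ = _+P_ ; _*_ = _*P_ ; -_ = -P_ ; 0# = [] ; 1# = constP (+ 1)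
  ; isCommutativeRing = record
    { isRing = record
      { +-isAbelianGroup = record
        { isGroup = record
          { isMonoid = record
            { isSemigroup = record
              { isMagma = record
                { isEquivalence = record { refl = ≋-refl ; sym = ≋-sym ; trans = ≋-trans }
                ; ∙-cong = +P-cong }
              ; assoc = +P-assoc }
            ; identity = (λ _ → ≋-refl) , +P-identityʳ }
          ; inverse = (λ p → ≋-trans (+P-comm (-P p) p) (-P-inverseʳ p)) , -P-inverseʳ
          ; ⁻¹-cong = scaleP-cong (ℤ.- (+ 1)) }
        ; comm = +P-comm }
      ; *-cong = *P-cong
      ; *-assoc = *P-assoc
      ; *-identity = *P-identityˡ , λ p → ≋-trans (*P-comm p _) (*P-identityˡ p)
      ; distrib = *P-distribˡ , *P-distribʳ }
    ; *-comm = *P-comm } }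

open CommutativeRing polyRing using (setoid; semiring; *-rawMagma; *-commutativeSemigroup; -‿cong)
open SemiringDivisibility semiring using (_∣_; _,_; 1∣_; _∣0; ∣ʳ-trans; ∣ʳ-respʳ-≈; ∣ʳ-respˡ-≈; x∣ʳy⇒x∣ʳzy)
open CommutativeSemigroupDivisibility *-commutativeSemigroup using (∙-cong-∣; x∣y⇒zx∣zy)
open RawMagmaDefinitions *-rawMagma using (module _∣ʳ_)
open SetoidReasoning setoid

-- Lets the ring solver recognise vanishing coefficients, which list arithmetic may leave as runs of
-- zeros instead of `[]`.
zero? : (p : Poly) → Maybe ([] ≋ p)
zero? []           = just ≋-refl
zero? (+ zero ∷ p) with zero? p
... | just e  = just (≋-trans (≋-sym 0∷[]) (∷-cong ≡.refl e))
... | nothing = nothing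
zero? (_ ∷ _)      = nothing

polyACR : AlmostCommutativeRing 0ℓ 0ℓ
polyACR = fromCommutativeRing polyRing zero?

1P 2P 3P : Poly
1P = constP (+ 1)
2P = constP (+ 2)
3P = constP (+ 3)

-- Finite differences and the (x²+4)-adic filtration

∣-+P : ∀ {d p q} → d ∣ p → d ∣ q → d ∣ p +P q
∣-+P {d} (a , e) (b , f) = a +P b , ≋-trans (*P-distribʳ d a b) (+P-cong e f)

∣--P : ∀ {d p} → d ∣ p → d ∣ -P p
∣--P {d} (a , e) = -P a , ≋-trans (neg-*P a d) (-‿cong e)
  where
  neg-*P : ∀ p q → (-P p) *P q ≋ -P (p *P q)
  neg-*P = solve-∀ polyACR

Δ : (ℤ → Poly) → ℤ → Poly
Δ F z = F (ℤ.suc z) +P -P F z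

-- The inner function is differenced first, so inductions on `n` generalise over `F` and an identity
-- for `Δ (Δ F)` can be used under `Δ^ n`.
Δ^ : ℕ → (ℤ → Poly) → ℤ → Poly
Δ^ zero    F = F
Δ^ (suc n) F = Δ^ n (Δ F)

Δ^-cong : ∀ n {F G} → (∀ z → F z ≋ G z) → ∀ z → Δ^ n F z ≋ Δ^ n G z
Δ^-cong zero    e = e
Δ^-cong (suc n) e = Δ^-cong n λ z → +P-cong (e (ℤ.suc z)) (-‿cong (e z))

Δ^-+P : ∀ n F G z → Δ^ n (λ z → F z +P G z) z ≋ Δ^ n F z +P Δ^ n G z
Δ^-+P zero    F G z = ≋-refl
Δ^-+P (suc n) F G z = ≋-trans
  (Δ^-cong n (λ z → rearrange (F (ℤ.suc z)) (G (ℤ.suc z)) (F z) (G z)) z) (Δ^-+P n (Δ F) (Δ G) z)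
  where
  rearrange : ∀ a b c d → (a +P b) +P -P (c +P d) ≋ (a +P -P c) +P (b +P -P d)
  rearrange = solve-∀ polyACR

Δ^-*P : ∀ n c F z → Δ^ n (λ z → c *P F z) z ≋ c *P Δ^ n F z
Δ^-*P zero    c F z = ≋-refl
Δ^-*P (suc n) c F z = ≋-trans
  (Δ^-cong n (λ z → rearrange c (F (ℤ.suc z)) (F z)) z) (Δ^-*P n c (Δ F) z)
  where
  rearrange : ∀ c a b → c *P a +P -P (c *P b) ≋ c *P (a +P -P b)
  rearrange = solve-∀ polyACR

Δ^-shift : ∀ n F z → Δ^ n (F ∘ ℤ.suc) z ≡ Δ^ n F (ℤ.suc z)
Δ^-shift zero    F z = ≡.refl
Δ^-shift (suc n) F z = Δ^-shift n (Δ F) z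

y^⌈_/2⌉ : ℕ → Poly
y^⌈ zero        /2⌉ = 1P
y^⌈ suc zero    /2⌉ = x²+4
y^⌈ suc (suc n) /2⌉ = x²+4 *P y^⌈ n /2⌉

-- ⌈m/2⌉ + ⌈n/2⌉ is at least ⌈(m+n)/2⌉; a spare factor `x²+4` appears exactly when both are odd.
y^⌈m+n/2⌉∣ : ∀ m n → y^⌈ m + n /2⌉ ∣ y^⌈ m /2⌉ *P y^⌈ n /2⌉
y^⌈m+n/2⌉∣ zero n = 1P , ≋-refl
y^⌈m+n/2⌉∣ (suc zero) zero = 1P , *P-comm 1P x²+4
y^⌈m+n/2⌉∣ (suc zero) (suc zero) = x²+4 , swap x²+4
  where
  swap : ∀ p → p *P (p *P 1P) ≋ p *P p
  swap = solve-∀ polyACR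
y^⌈m+n/2⌉∣ (suc zero) (suc (suc n)) = x∣y⇒zx∣zy x²+4 (y^⌈m+n/2⌉∣ 1 n)
y^⌈m+n/2⌉∣ (suc (suc m)) n =
  ∣ʳ-respʳ-≈ (≋-sym (*P-assoc x²+4 y^⌈ m /2⌉ y^⌈ n /2⌉)) (x∣y⇒zx∣zy x²+4 (y^⌈m+n/2⌉∣ m n))

-- Modulo (x²+4)^(j+1), such an F is a polynomial function of degree at most 2j - a.
Tame : ℕ → (ℤ → Poly) → Set
Tame a F = ∀ n z → y^⌈ n + a /2⌉ ∣ Δ^ n F z

tame-cong : ∀ {a F G} → (∀ z → F z ≋ G z) → Tame a F → Tame a G
tame-cong e t n z = ∣ʳ-respʳ-≈ (Δ^-cong n e z) (t n z)

tame-shift : ∀ {a F} → Tame a F → Tame a (F ∘ ℤ.suc)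
tame-shift {a} {F} t n z = ≡.subst (y^⌈ n + a /2⌉ ∣_) (≡.sym (Δ^-shift n F z)) (t n (ℤ.suc z))

-- The index `a` serves the induction on `n` in `tame-*P`: differencing one factor is recorded by
-- raising its index.
tame-Δ : ∀ {a F} → Tame a F → Tame (suc a) (Δ F)
tame-Δ {a} {F} t n z = ≡.subst (λ k → y^⌈ k /2⌉ ∣ Δ^ n (Δ F) z) (≡.sym (ℕ.+-suc n a)) (t (suc n) z)

tame-+P : ∀ {a F G} → Tame a F → Tame a G → Tame a (λ z → F z +P G z)
tame-+P t u n z = ∣ʳ-respʳ-≈ (≋-sym (Δ^-+P n _ _ z)) (∣-+P (t n z) (u n z))

tame-scale : ∀ {a F} c → Tame a F → Tame a (λ z → c *P F z)
tame-scale c t n z = ∣ʳ-respʳ-≈ (≋-sym (Δ^-*P n c _ z)) (x∣ʳy⇒x∣ʳzy c (t n z))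

Δ^-0 : ∀ n z → Δ^ n (λ _ → []) z ≡ []
Δ^-0 zero    z = ≡.refl
Δ^-0 (suc n) z = Δ^-0 n z

tame-const : ∀ c → Tame 0 (λ _ → c)
tame-const c zero    z = 1∣ c
tame-const c (suc n) z = ∣ʳ-respʳ-≈
  (≋-sym (≋-trans (Δ^-cong n (λ _ → -P-inverseʳ c) z) (coeffwise λ i → ≡.cong (λ p → coeff p i) (Δ^-0 n z))))
  (_ ∣0)

-- The discrete Leibniz rule Δ(FG) = ΔF·EG + F·ΔG, with E the shift.
tame-*P : ∀ {a b F G} → Tame a F → Tame b G → Tame (a + b) (λ z → F z *P G z)
tame-*P {a} {b} t u zero z = ∣ʳ-trans (y^⌈m+n/2⌉∣ a b) (∙-cong-∣ (t 0 z) (u 0 z))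
tame-*P {a} {b} {F} {G} t u (suc n) z =
  ≡.subst (λ k → y^⌈ k /2⌉ ∣ Δ^ (suc n) (λ z → F z *P G z) z) (ℕ.+-suc n (a + b))
   (∣ʳ-respʳ-≈ (≋-sym (≋-trans (Δ^-cong n (λ z → leibniz (F (ℤ.suc z)) (F z) (G (ℤ.suc z)) (G z)) z)
                           (Δ^-+P n _ _ z)))
     (∣-+P (tame-*P (tame-Δ {F = F} t) (tame-shift {F = G} u) n z)
       (≡.subst (λ k → y^⌈ n + k /2⌉ ∣ Δ^ n (λ z → F z *P Δ G z) z) (ℕ.+-suc a b)
         (tame-*P t (tame-Δ {F = G} u) n z))))
  where
  leibniz : ∀ f′ f g′ g → f′ *P g′ +P -P (f *P g) ≋ (f′ +P -P f) *P g′ +P f *P (g′ +P -P g)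
  leibniz = solve-∀ polyACR

-- Two differences are paid for by one factor `x²+4`. Divisibility for `H` is assumed at the single
-- order `n`, so that a recursive call can supply it.
tame-step : ∀ {F H} → (∀ z → Δ (Δ F) z ≋ x²+4 *P H (ℤ.suc z)) →
            ∀ n → (∀ z → y^⌈ n + 0 /2⌉ ∣ Δ^ n H z) → ∀ z → y^⌈ 2 + n + 0 /2⌉ ∣ Δ^ (2 + n) F z
tame-step {F} {H} e n t z = ∣ʳ-respʳ-≈
  (≋-sym (≋-trans (Δ^-cong n e z) (Δ^-*P n x²+4 (H ∘ ℤ.suc) z)))
  (x∣y⇒zx∣zy x²+4 (≡.subst (y^⌈ n + 0 /2⌉ ∣_) (≡.sym (Δ^-shift n H z)) (t (ℤ.suc z))))

-- Inverting 1 - (x²+4) q modulo a power of x²+4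

-- The partial sum of (1 - p)^i over i < j, in Horner form.
geometric : ℕ → Poly → Poly
geometric zero    p = []
geometric (suc j) p = 1P +P (1P +P -P p) *P geometric j p

tame-geometric : ∀ j {F} → Tame 0 F → Tame 0 (geometric j ∘ F)
tame-geometric zero        t = tame-const []
tame-geometric (suc j) {F} t = tame-+P {F = λ _ → 1P} {G = λ z → (1P +P -P F z) *P geometric j (F z)}
  (tame-const 1P)
  (tame-*P {F = λ z → 1P +P -P F z} {G = geometric j ∘ F}
    (tame-+P {F = λ _ → 1P} {G = λ z → -P F z} (tame-const 1P)
      (tame-cong {F = λ z → (-P 1P) *P F z} (λ z → neg (F z)) (tame-scale {F = F} (-P 1P) t)))
    (tame-geometric j t))
  where
  neg : ∀ p → (-P 1P) *P p ≋ -P p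
  neg = solve-∀ polyACR

-- The error 1 - p g is exactly (1 - p)^j: each step of `geometric` multiplies it by 1 - p.
geometric-inverse : ∀ {d p} → d ∣ 1P +P -P p → ∀ j → powP d j ∣ 1P +P -P (p *P geometric j p)
geometric-inverse {d} {p} d∣1-p zero    = 1∣ _
geometric-inverse {d} {p} d∣1-p (suc j) = ∣ʳ-respʳ-≈ (factor p (geometric j p))
  (∙-cong-∣ d∣1-p (geometric-inverse {d} {p} d∣1-p j))
  where
  factor : ∀ p g → (1P +P -P p) *P (1P +P -P (p *P g)) ≋ 1P +P -P (p *P (1P +P (1P +P -P p) *P g))
  factor = solve-∀ polyACR

-- Extensions from ℕ to ℤ along the reflection k ↦ -1 - k

-- `-[1+ k ]` is -1 - k, so the reflection merely swaps the two constructors and has no fixed point.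
evenExt oddExt : (ℕ → Poly) → ℤ → Poly
evenExt f (+ k)    = f k
evenExt f -[1+ k ] = f k
oddExt  f (+ k)    = f k
oddExt  f -[1+ k ] = -P f k

-- The second difference of an odd function, centred.
δ² : (ℕ → Poly) → ℕ → Poly
δ² f zero    = f 1 +P -P (3P *P f 0)
δ² f (suc k) = f (2 + k) +P -P (2P *P f (suc k)) +P f k

δ²^ : ℕ → (ℕ → Poly) → ℕ → Poly
δ²^ zero    f = f
δ²^ (suc m) f = δ²^ m (δ² f)

-- A forward second difference at `z` is centred at z + 1. At the centres 0 and -1 one neighbour
-- lies across the reflection and is the negated centre value, which produces the coefficient 3 in
-- `δ²`.
Δ²-oddExt : ∀ f z → Δ (Δ (oddExt f)) z ≋ oddExt (δ² f) (ℤ.suc z)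
Δ²-oddExt f (+ k) = rearrange (f (2 + k)) (f (suc k)) (f k)
  where
  rearrange : ∀ a b c → (a +P -P b) +P -P (b +P -P c) ≋ a +P -P (2P *P b) +P c
  rearrange = solve-∀ polyACR
Δ²-oddExt f -[1+ zero ] = rearrange (f 1) (f 0)
  where
  rearrange : ∀ a b → (a +P -P b) +P -P (b +P -P (-P b)) ≋ a +P -P (3P *P b)
  rearrange = solve-∀ polyACR
Δ²-oddExt f -[1+ suc zero ] = rearrange (f 0) (f 1)
  where
  rearrange : ∀ a b → (a +P -P (-P a)) +P -P ((-P a) +P -P (-P b)) ≋ -P (b +P -P (3P *P a))
  rearrange = solve-∀ polyACR
Δ²-oddExt f -[1+ suc (suc k) ] = rearrange (f k) (f (suc k)) (f (2 + k))
  where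
  rearrange : ∀ a b c →
    ((-P a) +P -P (-P b)) +P -P ((-P b) +P -P (-P c)) ≋ -P (c +P -P (2P *P b) +P a)
  rearrange = solve-∀ polyACR

-- The points -1-m, ..., m are symmetric under the reflection. Each `Δ (Δ _)` becomes a `δ²` and
-- moves the base point one step inward, until f(0) - (-f(0)) remains at -1.
Δ-oddExt-centre : ∀ m f → Δ^ (1 + m * 2) (oddExt f) -[1+ m ] ≋ 2P *P δ²^ m f 0
Δ-oddExt-centre zero    f = rearrange (f 0)
  where
  rearrange : ∀ a → a +P -P (-P a) ≋ 2P *P a
  rearrange = solve-∀ polyACR
Δ-oddExt-centre (suc m) f = begin
  Δ^ (1 + m * 2) (Δ (Δ (oddExt f))) -[1+ suc m ]        ≈⟨ Δ^-cong (1 + m * 2) (Δ²-oddExt f) -[1+ suc m ] ⟩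
  Δ^ (1 + m * 2) (oddExt (δ² f) ∘ ℤ.suc) -[1+ suc m ]   ≡⟨ Δ^-shift (1 + m * 2) (oddExt (δ² f)) -[1+ suc m ] ⟩
  Δ^ (1 + m * 2) (oddExt (δ² f)) -[1+ m ]               ≈⟨ Δ-oddExt-centre m (δ² f) ⟩
  2P *P δ²^ m (δ² f) 0                                  ∎

-- Natural numbers as constant polynomials

num : ℕ → Poly
num n = constP (+ n)

≋-reflexive : ∀ {p q} → p ≡ q → p ≋ q
≋-reflexive ≡.refl = ≋-refl

num-* : ∀ m n → num (m * n) ≋ num m *P num n
num-* m n = ∷-cong (≡.trans (ℤ.pos-* m n) (≡.sym (ℤ.+-identityʳ _))) ≋-refl

num-0 : ∀ {n} → n ≡ 0 → num n ≋ []
num-0 ≡.refl = 0∷[]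

-- Binomial coefficients

C-Pascal : ∀ n k → suc n C suc k ≡ n C k + n C suc k
C-Pascal n k = ≡.sym (nCk+nC[k+1]≡[n+1]C[k+1] n k)

C-Pascal² : ∀ n k → (2 + n) C (2 + k) ≡ n C k + 2 * (n C suc k) + n C (2 + k)
C-Pascal² n k
  rewrite C-Pascal (suc n) (suc k) | C-Pascal n k | C-Pascal n (suc k) = rearrange (n C k) (n C suc k) (n C (2 + k))
  where
  rearrange : ∀ a b c → (a + b) + (b + c) ≡ a + 2 * b + c
  rearrange = ℕ-Solver.solve-∀

C-second-difference : ∀ n k → (2 + n) C (2 + k) + n C (2 + k) ≡ 2 * (suc n C (2 + k)) + n C k
C-second-difference n k rewrite C-Pascal² n k | C-Pascal n (suc k) = rearrange (n C k) (n C suc k) (n C (2 + k))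
  where
  rearrange : ∀ a b c → (a + 2 * b + c) + c ≡ 2 * (b + c) + a
  rearrange = ℕ-Solver.solve-∀

C-edge : ∀ {n k} → n ≤ k → (2 + n) C (2 + k) ≡ n C k
C-edge {n} {k} n≤k = ≡.trans (C-Pascal² n k)
  (≡.trans (≡.cong₂ (λ a b → n C k + 2 * a + b) (k>n⇒nCk≡0 (s≤s n≤k)) (k>n⇒nCk≡0 (s≤s (ℕ.m≤n⇒m≤1+n n≤k))))
    (simplify (n C k)))
  where
  simplify : ∀ a → a + 0 + 0 ≡ a
  simplify = ℕ-Solver.solve-∀

C-absorption : ∀ n k → suc k * (suc n C suc k) ≡ suc n * (n C k)
C-absorption n zero = ≡.trans (ℕ.*-identityˡ _) (≡.trans (nC1≡n (suc n)) (≡.sym (ℕ.*-identityʳ (suc n))))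
C-absorption zero (suc k) = ≡.trans
  (≡.cong ((2 + k) *_) (k>n⇒nCk≡0 {1} {2 + k} (s≤s (s≤s z≤n)))) (ℕ.*-zeroʳ (2 + k))
C-absorption (suc n) (suc k) = ≡.trans (≡.cong ((2 + k) *_) (C-Pascal (suc n) (suc k)))
  (≡.trans (split (suc k) (suc n C suc k) _)
  (≡.trans (≡.cong₂ (λ a b → suc n C suc k + a + b) (C-absorption n k) (C-absorption n (suc k)))
  (≡.trans (collect (suc n) (suc n C suc k) (n C k) _)
    (≡.cong (λ c → suc n C suc k + suc n * c) (nCk+nC[k+1]≡[n+1]C[k+1] n k)))))
  where
  split : ∀ k a b → suc k * (a + b) ≡ a + k * a + suc k * b
  split = ℕ-Solver.solve-∀
  collect : ∀ n a b c → a + n * b + n * c ≡ a + n * (b + c)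
  collect = ℕ-Solver.solve-∀

C-central : ∀ m → (1 + m * 2) C m ≡ (1 + m * 2) C suc m
C-central m = ≡.trans (nCk≡nC[n∸k] (ℕ.≤-trans (ℕ.m≤m*n m 2) (ℕ.n≤1+n _)))
  (≡.cong ((1 + m * 2) C_) (≡.trans (≡.cong (_∸ m) (double m)) (ℕ.m+n∸m≡n m (suc m))))
  where
  double : ∀ m → 1 + m * 2 ≡ m + suc m
  double = ℕ-Solver.solve-∀

-- (2k+1)/(2s+1) · C(k+s, 2s), an odd polynomial in 2k+1 of degree 2s+1
oddBinomial : ℕ → ℕ → ℕ
oddBinomial s k = (k + s) C (1 + s * 2) + (1 + k + s) C (1 + s * 2)

-- Adding (2s+1) C(k+s, 2s) to the left side completes it by Pascal's rule to 2(2s+1) C(k+s+1,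
-- 2s+1), which absorption turns into 2(k+s+1) C(k+s, 2s).
oddBinomial-scaled : ∀ s k → (1 + s * 2) * oddBinomial s k ≡ (1 + k * 2) * ((k + s) C (s * 2))
oddBinomial-scaled s k = ℕ.+-cancelʳ-≡ ((1 + s * 2) * c) _ _
  (≡.trans (regroup (1 + s * 2) c (n C (1 + s * 2)) (suc n C (1 + s * 2)))
  (≡.trans (≡.cong (λ a → (1 + s * 2) * (suc n C (1 + s * 2) + a)) (nCk+nC[k+1]≡[n+1]C[k+1] n (s * 2)))
  (≡.trans (double (1 + s * 2) (suc n C (1 + s * 2)))
  (≡.trans (≡.cong (2 *_) (C-absorption n (s * 2))) (collect s k c)))))
  where
  n c : ℕ
  n = k + s
  c = n C (s * 2)
  regroup : ∀ r c a b → r * (a + b) + r * c ≡ r * (b + (c + a))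
  regroup = ℕ-Solver.solve-∀
  double : ∀ r a → r * (a + a) ≡ 2 * (r * a)
  double = ℕ-Solver.solve-∀
  collect : ∀ s k c → 2 * (suc (k + s) * c) ≡ (1 + k * 2) * c + (1 + s * 2) * c
  collect = ℕ-Solver.solve-∀

k<s⇒oddBinomial≡0 : ∀ {s k} → k < s → oddBinomial s k ≡ 0
k<s⇒oddBinomial≡0 {s} {k} k<s = ≡.cong₂ _+_
  (k>n⇒nCk≡0 (ℕ.m<n⇒m<1+n 1+k+s≤2s)) (k>n⇒nCk≡0 (s≤s 1+k+s≤2s))
  where
  1+k+s≤2s : suc k + s ≤ s * 2
  1+k+s≤2s = ℕ.≤-trans (ℕ.+-monoˡ-≤ s k<s) (ℕ.≤-reflexive (double s))
    where
    double : ∀ s → s + s ≡ s * 2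
    double = ℕ-Solver.solve-∀

oddBinomial-edge : ∀ s → oddBinomial (suc s) 1 ≡ oddBinomial s 0
oddBinomial-edge s = ≡.cong₂ _+_ (C-edge (ℕ.≤-trans s≤2s (ℕ.n≤1+n _))) (C-edge (s≤s s≤2s))
  where
  s≤2s : s ≤ s * 2
  s≤2s = ℕ.m≤m*n s 2

oddBinomial-0 : ∀ k → oddBinomial 0 k ≡ 1 + k * 2
oddBinomial-0 k = ≡.trans (≡.cong₂ _+_ (nC1≡n (k + 0)) (nC1≡n (1 + k + 0))) (collect k)
  where
  collect : ∀ k → (k + 0) + (1 + k + 0) ≡ 1 + k * 2
  collect = ℕ-Solver.solve-∀

oddBinomial-second-difference : ∀ s k →
  oddBinomial (suc s) (2 + k) + oddBinomial (suc s) k ≡ 2 * oddBinomial (suc s) (suc k) + oddBinomial s (suc k)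
oddBinomial-second-difference s k rewrite ℕ.+-suc k s =
  ≡.trans (interchange (n₃ C r) (n₄ C r) (n₁ C r) (n₂ C r))
  (≡.trans (≡.cong₂ _+_ (C-second-difference n₁ (1 + s * 2)) (C-second-difference n₂ (1 + s * 2)))
    (collect (n₂ C r) (n₃ C r) (n₁ C (1 + s * 2)) _))
  where
  r n₁ n₂ n₃ n₄ : ℕ
  r = 3 + s * 2
  n₁ = 1 + k + s
  n₂ = 2 + k + s
  n₃ = 3 + k + s
  n₄ = 4 + k + s
  interchange : ∀ a b c d → (a + b) + (c + d) ≡ (a + c) + (b + d)
  interchange = ℕ-Solver.solve-∀
  collect : ∀ a b c d → (2 * a + c) + (2 * b + d) ≡ 2 * (a + b) + (c + d)
  collect = ℕ-Solver.solve-∀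

-- Each second difference lowers `s` by one; this matches the one power of `x²+4` by which
-- `scaledKernel (suc s)` exceeds `scaledKernel s`.
δ²-oddBinomial : ∀ s k → δ² (num ∘ oddBinomial (suc s)) k ≋ num (oddBinomial s k)
δ²-oddBinomial s zero = begin
  num (oddBinomial (suc s) 1) +P -P (3P *P num (oddBinomial (suc s) 0))
    ≈⟨ +P-cong (≋-reflexive (≡.cong num (oddBinomial-edge s)))
         (-‿cong (*P-congˡ 3P (num-0 (k<s⇒oddBinomial≡0 {suc s} {0} (s≤s z≤n))))) ⟩
  num (oddBinomial s 0) +P -P (3P *P [])
    ≈⟨ simplify (num (oddBinomial s 0)) ⟩
  num (oddBinomial s 0) ∎
  where
  simplify : ∀ p → p +P -P (3P *P []) ≋ p
  simplify = solve-∀ polyACR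
δ²-oddBinomial s (suc k) = begin
  num b₂ +P -P (2P *P num b₁) +P num b₀        ≈⟨ +P-rotate (num b₂) (2P *P num b₁) (num b₀) ⟩
  num (b₂ + b₀) +P -P (2P *P num b₁)           ≡⟨ ≡.cong (λ b → num b +P -P (2P *P num b₁)) (oddBinomial-second-difference s k) ⟩
  num (2 * b₁) +P num b +P -P (2P *P num b₁)   ≈⟨ +P-congʳ (-P (2P *P num b₁)) (+P-congʳ (num b) (num-* 2 b₁)) ⟩
  2P *P num b₁ +P num b +P -P (2P *P num b₁)   ≈⟨ +P-cancel (2P *P num b₁) (num b) ⟩
  num b                                        ∎
  where
  b b₀ b₁ b₂ : ℕ
  b = oddBinomial s (suc k)
  b₀ = oddBinomial (suc s) k
  b₁ = oddBinomial (suc s) (suc k)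
  b₂ = oddBinomial (suc s) (2 + k)
  +P-rotate : ∀ p q r → p +P -P q +P r ≋ p +P r +P -P q
  +P-rotate = solve-∀ polyACR
  +P-cancel : ∀ p q → p +P q +P -P p ≋ q
  +P-cancel = solve-∀ polyACR

-- Lucas polynomials of odd index

sgn : ℕ → Poly
sgn zero    = 1P
sgn (suc k) = -P sgn k

sgn² : ∀ k → sgn k *P sgn k ≋ 1P
sgn² zero    = *P-identityˡ 1P
sgn² (suc k) = ≋-trans (neg² (sgn k)) (sgn² k)
  where
  neg² : ∀ p → (-P p) *P (-P p) ≋ p *P p
  neg² = solve-∀ polyACR

-- (-1)^k L_{2k+1}(x) / x, as a polynomial in x²+4 with constant term 1
reducedLucas : ℕ → Poly
reducedLucas zero          = 1P
reducedLucas (suc zero)    = 1P +P -P x²+4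
reducedLucas (suc (suc k)) =
  2P *P reducedLucas (suc k) +P -P reducedLucas k +P -P (x²+4 *P reducedLucas (suc k))

lucas-odd-step : ∀ k → lucas (5 + k) ≋ (X *P X +P 2P) *P lucas (3 + k) +P -P lucas (1 + k)
lucas-odd-step k = step X (lucas (2 + k)) (lucas (1 + k))
  where
  step : ∀ x a b → x *P (x *P (x *P a +P b) +P a) +P (x *P a +P b) ≋
                   (x *P x +P 2P) *P (x *P a +P b) +P -P b
  step = solve-∀ polyACR

-- The alternating sign turns the multiplier x²+2 of `lucas-odd-step` into -(x²+2) = 2 - (x²+4), the
-- multiplier in `reducedLucas`.
lucas≋reducedLucas : ∀ k → lucas (1 + k * 2) ≋ sgn k *P (X *P reducedLucas k)
lucas≋reducedLucas zero       = ≋-refl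
lucas≋reducedLucas (suc zero) = ≋-refl
lucas≋reducedLucas (suc (suc k)) = begin
  lucas (5 + k * 2)                                                   ≈⟨ lucas-odd-step (k * 2) ⟩
  (X *P X +P 2P) *P lucas (3 + k * 2) +P -P lucas (1 + k * 2)
    ≈⟨ +P-cong (*P-congˡ (X *P X +P 2P) (lucas≋reducedLucas (suc k))) (-‿cong (lucas≋reducedLucas k)) ⟩
  (X *P X +P 2P) *P ((-P sgn k) *P (X *P reducedLucas (suc k))) +P -P (sgn k *P (X *P reducedLucas k))
    ≈⟨ collect (sgn k) (reducedLucas (suc k)) (reducedLucas k) ⟩
  sgn (2 + k) *P (X *P reducedLucas (2 + k))                          ∎
  where
  collect : ∀ e a b → (X *P X +P 2P) *P ((-P e) *P (X *P a)) +P -P (e *P (X *P b)) ≋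
                      (-P (-P e)) *P (X *P (2P *P a +P -P b +P -P (x²+4 *P a)))
  collect = solve-∀ polyACR

-- Modulo `x²+4` the recurrence is that of an arithmetic progression, and it starts with 1, 1.
x²+4∣1-reducedLucas : ∀ k → x²+4 ∣ 1P +P -P reducedLucas k
x²+4∣1-reducedLucas zero          = [] , ≋-sym (-P-inverseʳ 1P)
x²+4∣1-reducedLucas (suc zero)    = 1P , ≋-refl
x²+4∣1-reducedLucas (suc (suc k)) = ∣ʳ-respʳ-≈ (collect (reducedLucas (suc k)) (reducedLucas k))
  (∣-+P (∣-+P (x∣ʳy⇒x∣ʳzy 2P (x²+4∣1-reducedLucas (suc k))) (∣--P (x²+4∣1-reducedLucas k)))
        (reducedLucas (suc k) , *P-comm _ x²+4))
  where
  collect : ∀ a b → 2P *P (1P +P -P a) +P -P (1P +P -P b) +P x²+4 *P a ≋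
                    1P +P -P (2P *P a +P -P b +P -P (x²+4 *P a))
  collect = solve-∀ polyACR

-- Tameness of the reduced Lucas polynomials and of the scaled weights

Δ²-evenExt-reducedLucas : ∀ z →
  Δ (Δ (evenExt reducedLucas)) z ≋ x²+4 *P ((-P 1P) *P evenExt reducedLucas (ℤ.suc z))
Δ²-evenExt-reducedLucas (+ k) = expand (reducedLucas (suc k)) (reducedLucas k)
  where
  expand : ∀ a b → (2P *P a +P -P b +P -P (x²+4 *P a) +P -P a) +P -P (a +P -P b) ≋ x²+4 *P ((-P 1P) *P a)
  expand = solve-∀ polyACR
-- The centres 0 and -1, next to the reflection: both compute to (1 - y) - 2 + 1 = -y with y = x²+4.
Δ²-evenExt-reducedLucas -[1+ zero ] = ≋-refl
Δ²-evenExt-reducedLucas -[1+ suc zero ] = ≋-refl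
Δ²-evenExt-reducedLucas -[1+ suc (suc k) ] = expand (reducedLucas (suc k)) (reducedLucas k)
  where
  expand : ∀ a b → (b +P -P a) +P -P (a +P -P (2P *P a +P -P b +P -P (x²+4 *P a))) ≋ x²+4 *P ((-P 1P) *P a)
  expand = solve-∀ polyACR

x²+4∣1-evenExt-reducedLucas : ∀ z → x²+4 ∣ 1P +P -P evenExt reducedLucas z
x²+4∣1-evenExt-reducedLucas (+ k)    = x²+4∣1-reducedLucas k
x²+4∣1-evenExt-reducedLucas -[1+ k ] = x²+4∣1-reducedLucas k

-- The second difference reproduces the function times -(x²+4), so order n+2 rests on order n; order
-- 1 holds because all values are 1 modulo x²+4.
tame-reducedLucas : Tame 0 (evenExt reducedLucas)
tame-reducedLucas zero z = 1∣ _
tame-reducedLucas (suc zero) z = ∣ʳ-respʳ-≈ (telescope (evenExt reducedLucas z) (evenExt reducedLucas (ℤ.suc z)))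
  (∣-+P (x²+4∣1-evenExt-reducedLucas z) (∣--P (x²+4∣1-evenExt-reducedLucas (ℤ.suc z))))
  where
  telescope : ∀ a b → (1P +P -P a) +P -P (1P +P -P b) ≋ b +P -P a
  telescope = solve-∀ polyACR
tame-reducedLucas (suc (suc n)) = tame-step {evenExt reducedLucas} {λ z → (-P 1P) *P evenExt reducedLucas z}
  Δ²-evenExt-reducedLucas n λ z →
    ∣ʳ-respʳ-≈ (≋-sym (Δ^-*P n (-P 1P) (evenExt reducedLucas) z)) (x∣ʳy⇒x∣ʳzy (-P 1P) (tame-reducedLucas n z))

-- The odd extension has degree 2s+1 in z, hence is tame only after multiplication by (x²+4)^(s+1).
scaledKernel : ℕ → ℤ → Poly
scaledKernel s z = powP x²+4 (suc s) *P oddExt (num ∘ oddBinomial s) z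

x²+4∣scaledKernel : ∀ s z → x²+4 ∣ scaledKernel s z
x²+4∣scaledKernel s z = powP x²+4 s *P b , rearrange x²+4 (powP x²+4 s) b
  where
  b = oddExt (num ∘ oddBinomial s) z
  rearrange : ∀ y q b → (q *P b) *P y ≋ (y *P q) *P b
  rearrange = solve-∀ polyACR

oddExt-cong : ∀ {f g} → (∀ k → f k ≋ g k) → ∀ z → oddExt f z ≋ oddExt g z
oddExt-cong e (+ k)    = e k
oddExt-cong e -[1+ k ] = -‿cong (e k)

Δ²-scaledKernel : ∀ s z → Δ (Δ (scaledKernel s)) z ≋ powP x²+4 (suc s) *P oddExt (δ² (num ∘ oddBinomial s)) (ℤ.suc z)
Δ²-scaledKernel s z = ≋-trans (Δ^-*P 2 (powP x²+4 (suc s)) (oddExt (num ∘ oddBinomial s)) z)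
  (*P-congˡ (powP x²+4 (suc s)) (Δ²-oddExt (num ∘ oddBinomial s) z))

δ²-cong : ∀ {f g} → (∀ k → f k ≋ g k) → ∀ k → δ² f k ≋ δ² g k
δ²-cong e zero    = +P-cong (e 1) (-‿cong (*P-congˡ 3P (e 0)))
δ²-cong e (suc k) = +P-cong (+P-cong (e (2 + k)) (-‿cong (*P-congˡ 2P (e (suc k))))) (e k)

δ²-oddBinomial-0 : ∀ k → δ² (num ∘ oddBinomial 0) k ≋ []
δ²-oddBinomial-0 zero = 0∷[]
δ²-oddBinomial-0 (suc k) = ≋-trans (δ²-cong (λ k → ≋-reflexive (≡.cong num (oddBinomial-0 k))) (suc k))
  (collect (num (1 + k * 2)))
  where
  collect : ∀ a → (2P +P (2P +P a)) +P -P (2P *P (2P +P a)) +P a ≋ []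
  collect = solve-∀ polyACR

oddExt-0 : ∀ z → oddExt (λ _ → []) z ≋ []
oddExt-0 (+ k)    = ≋-refl
oddExt-0 -[1+ k ] = ≋-refl

-- Each second difference releases one factor `x²+4` and lowers `s`; at s = 0 the weights 2k+1 are
-- linear and their second difference vanishes. A first difference takes just one of the s+1
-- factors.
tame-scaledKernel : ∀ s → Tame 0 (scaledKernel s)
tame-scaledKernel s zero       z = 1∣ _
tame-scaledKernel s (suc zero) z = ∣-+P (x²+4∣scaledKernel s (ℤ.suc z)) (∣--P (x²+4∣scaledKernel s z))
tame-scaledKernel zero (suc (suc n)) = tame-step {scaledKernel 0} {λ _ → []}
  (λ z → ≋-trans (Δ²-scaledKernel 0 z)
    (≋-trans (*P-congˡ (powP x²+4 1) (≋-trans (oddExt-cong δ²-oddBinomial-0 (ℤ.suc z)) (oddExt-0 (ℤ.suc z))))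
      (≋-trans (*P-zeroʳ (powP x²+4 1)) (≋-sym (*P-zeroʳ x²+4)))))
  n (tame-const [] n)
tame-scaledKernel (suc s) (suc (suc n)) = tame-step {scaledKernel (suc s)} {scaledKernel s}
  (λ z → ≋-trans (Δ²-scaledKernel (suc s) z)
    (≋-trans (*P-congˡ (powP x²+4 (2 + s)) (oddExt-cong (δ²-oddBinomial s) (ℤ.suc z)))
             (*P-assoc x²+4 (powP x²+4 (suc s)) (oddExt (num ∘ oddBinomial s) (ℤ.suc z)))))
  n (tame-scaledKernel s n)

-- Finite sums

Σ< : ℕ → (ℕ → Poly) → Poly
Σ< n f = sumP (applyUpTo f n)

Σ<-cong : ∀ n {f g} → (∀ k → k < n → f k ≋ g k) → Σ< n f ≋ Σ< n g
Σ<-cong zero    e = ≋-refl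
Σ<-cong (suc n) e = +P-cong (e 0 (s≤s z≤n)) (Σ<-cong n λ k k<n → e (suc k) (s≤s k<n))

Σ<-0 : ∀ n {f} → (∀ k → f k ≋ []) → Σ< n f ≋ []
Σ<-0 zero    e = ≋-refl
Σ<-0 (suc n) e = +P-cong (e 0) (Σ<-0 n (e ∘ suc))

Σ<-scale : ∀ n c f → Σ< n (λ k → c *P f k) ≋ c *P Σ< n f
Σ<-scale zero    c f = ≋-sym (*P-zeroʳ c)
Σ<-scale (suc n) c f = ≋-trans (+P-congˡ (c *P f 0) (Σ<-scale n c (f ∘ suc))) (≋-sym (*P-distribˡ c (f 0) _))

Σ<-drop : ∀ s n {f} → (∀ k → k < s → f k ≋ []) → Σ< (s + n) f ≋ Σ< n (λ i → f (s + i))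
Σ<-drop zero    n e = ≋-refl
Σ<-drop (suc s) n e = +P-cong (e 0 (s≤s z≤n)) (Σ<-drop s n λ k k<s → e (suc k) (s≤s k<s))

∣-Σ<-difference : ∀ {d} n {f g} → (∀ k → k < n → d ∣ f k +P -P g k) → d ∣ Σ< n f +P -P Σ< n g
∣-Σ<-difference zero    h = _ ∣0
∣-Σ<-difference (suc n) {f} {g} h = ∣ʳ-respʳ-≈
  (interchange (f 0) (g 0) (Σ< n (f ∘ suc)) (Σ< n (g ∘ suc)))
  (∣-+P (h 0 (s≤s z≤n)) (∣-Σ<-difference n λ k k<n → h (suc k) (s≤s k<n)))
  where
  interchange : ∀ a b c d → (a +P -P b) +P (c +P -P d) ≋ (a +P c) +P -P (b +P d)
  interchange = solve-∀ polyACR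

-- Summation by parts, twice. The brackets are the boundary terms at the two ends; k = 0 is left out
-- because `δ²` has its own formula there.
Σ<-Green : ∀ n t f →
  Σ< n (λ k → δ² t (suc k) *P f (suc k)) +P (t 1 *P f 0 +P -P (t 0 *P f 1)) ≋
  Σ< n (λ k → t (suc k) *P δ² f (suc k)) +P (t (suc n) *P f n +P -P (t n *P f (suc n)))
Σ<-Green zero    t f = ≋-refl
Σ<-Green (suc n) t f = ≋-trans (split (t 0) (t 1) (t 2) (f 0) (f 1) (f 2) _)
  (≋-trans (+P-congˡ (t 1 *P δ² f 1) (Σ<-Green n (t ∘ suc) (f ∘ suc)))
    (≋-sym (+P-assoc (t 1 *P δ² f 1) (Σ< n (λ k → t (2 + k) *P δ² f (2 + k))) _)))
  where
  split : ∀ t₀ t₁ t₂ f₀ f₁ f₂ r →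
    ((t₂ +P -P (2P *P t₁) +P t₀) *P f₁ +P r) +P (t₁ *P f₀ +P -P (t₀ *P f₁)) ≋
    t₁ *P (f₂ +P -P (2P *P f₁) +P f₀) +P (r +P (t₂ *P f₁ +P -P (t₁ *P f₂)))
  split = solve-∀ polyACR

-- At 0 both sides contain -3 t(0) f(0), and the remaining cross terms are the lower boundary term
-- of `Σ<-Green`; the hypotheses kill the upper one.
δ²-selfAdjoint : ∀ n t f → t n ≋ [] → t (suc n) ≋ [] →
  Σ< (suc n) (λ k → δ² t k *P f k) ≋ Σ< (suc n) (λ k → t k *P δ² f k)
δ²-selfAdjoint n t f tₙ≋0 tₙ₊₁≋0 = begin
  δ² t 0 *P f 0 +P S                                        ≈⟨ split (t 0) (t 1) (f 0) (f 1) S ⟩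
  t 0 *P δ² f 0 +P (S +P (t 1 *P f 0 +P -P (t 0 *P f 1)))   ≈⟨ +P-congˡ (t 0 *P δ² f 0) (Σ<-Green n t f) ⟩
  t 0 *P δ² f 0 +P (S′ +P (t (suc n) *P f n +P -P (t n *P f (suc n))))
    ≈⟨ +P-congˡ (t 0 *P δ² f 0) (+P-congˡ S′ (+P-cong (*P-cong tₙ₊₁≋0 ≋-refl) (-‿cong (*P-cong tₙ≋0 ≋-refl)))) ⟩
  t 0 *P δ² f 0 +P (S′ +P [])                               ≈⟨ +P-congˡ (t 0 *P δ² f 0) (+P-identityʳ S′) ⟩
  t 0 *P δ² f 0 +P S′                                       ∎
  where
  S S′ : Poly
  S  = Σ< n (λ k → δ² t (suc k) *P f (suc k))
  S′ = Σ< n (λ k → t (suc k) *P δ² f (suc k))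
  split : ∀ t₀ t₁ f₀ f₁ r →
    (t₁ +P -P (3P *P t₀)) *P f₀ +P r ≋
    t₀ *P (f₁ +P -P (3P *P f₀)) +P (r +P (t₁ *P f₀ +P -P (t₀ *P f₁)))
  split = solve-∀ polyACR

-- This is (-1)^k C(2m+1, m-k) with the lower index reflected to m+1+k, which avoids truncated
-- subtraction and makes it vanish for k > m.
signedCentral : ℕ → ℕ → Poly
signedCentral m k = sgn k *P num ((1 + m * 2) C suc (m + k))

signedCentral-vanishes : ∀ {m k} → m < k → signedCentral m k ≋ []
signedCentral-vanishes {m} {k} m<k = ≋-trans (*P-congˡ (sgn k) (num-0 (k>n⇒nCk≡0 (s≤s 1+2m≤m+k)))) (*P-zeroʳ (sgn k))
  where
  double : ∀ m → 1 + m * 2 ≡ m + suc m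
  double = ℕ-Solver.solve-∀
  1+2m≤m+k : 1 + m * 2 ≤ m + k
  1+2m≤m+k = ℕ.≤-trans (ℕ.≤-reflexive (double m)) (ℕ.+-monoʳ-≤ m m<k)

num-Pascal² : ∀ n k → num ((2 + n) C (2 + k)) ≋ num (n C k) +P 2P *P num (n C suc k) +P num (n C (2 + k))
num-Pascal² n k = ≋-trans (≋-reflexive (≡.cong num (C-Pascal² n k)))
  (+P-congʳ (num (n C (2 + k))) (+P-congˡ (num (n C k)) (num-* 2 (n C suc k))))

-- Pascal's rule applied twice; the alternating signs turn the -2 of `δ²` into +2. At k = 0 the
-- coefficient 3 splits as 1 + 2, because the two central binomial coefficients agree.
δ²-signedCentral : ∀ m k → δ² (signedCentral m) k ≋ -P signedCentral (suc m) k
δ²-signedCentral m zero = begin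
  (-P 1P) *P num (N C suc (m + 1)) +P -P (3P *P (1P *P num (N C suc (m + 0))))
    ≡⟨ ≡.cong₂ (λ i j → (-P 1P) *P num (N C suc i) +P -P (3P *P (1P *P num (N C suc j)))) (ℕ.+-comm m 1) (ℕ.+-identityʳ m) ⟩
  (-P 1P) *P c₂ +P -P (3P *P (1P *P c₁))                    ≈⟨ collect c₁ c₂ ⟩
  -P (1P *P (c₁ +P 2P *P c₁ +P c₂))
    ≈⟨ -‿cong (*P-congˡ 1P (+P-congʳ c₂ (+P-congʳ (2P *P c₁) (≋-reflexive (≡.cong num (≡.sym (C-central m))))))) ⟩
  -P (1P *P (num (N C m) +P 2P *P c₁ +P c₂))                ≈⟨ -‿cong (*P-congˡ 1P (≋-sym (num-Pascal² N m))) ⟩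
  -P (1P *P num ((2 + N) C (2 + m)))                        ≡⟨ ≡.cong (λ i → -P (1P *P num ((2 + N) C (2 + i)))) (≡.sym (ℕ.+-identityʳ m)) ⟩
  -P (1P *P num ((2 + N) C (2 + (m + 0))))                  ∎
  where
  N : ℕ
  N = 1 + m * 2
  c₁ c₂ : Poly
  c₁ = num (N C suc m)
  c₂ = num (N C (2 + m))
  collect : ∀ a b → (-P 1P) *P b +P -P (3P *P (1P *P a)) ≋ -P (1P *P (a +P 2P *P a +P b))
  collect = solve-∀ polyACR
δ²-signedCentral m (suc k) = begin
  e *P num (N C suc (m + (2 + k))) +P -P (2P *P (e′ *P num (N C suc (m + suc k)))) +P sgn k *P num (N C suc (m + k))
    ≡⟨ ≡.cong₂ (λ i j → e *P num (N C suc i) +P -P (2P *P (e′ *P num (N C suc j))) +P sgn k *P num (N C suc (m + k)))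
         (≡.trans (ℕ.+-suc m (suc k)) (≡.cong suc (ℕ.+-suc m k))) (ℕ.+-suc m k) ⟩
  e *P c₃ +P -P (2P *P (e′ *P c₂)) +P sgn k *P c₁           ≈⟨ collect (sgn k) c₁ c₂ c₃ ⟩
  -P (e′ *P (c₁ +P 2P *P c₂ +P c₃))                         ≈⟨ -‿cong (*P-congˡ e′ (≋-sym (num-Pascal² N (suc (m + k))))) ⟩
  -P (e′ *P num ((2 + N) C (3 + (m + k))))                  ≡⟨ ≡.cong (λ i → -P (e′ *P num ((2 + N) C (2 + i)))) (≡.sym (ℕ.+-suc m k)) ⟩
  -P (e′ *P num ((2 + N) C (2 + (m + suc k))))              ∎
  where
  N : ℕ
  N = 1 + m * 2
  e e′ c₁ c₂ c₃ : Poly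
  e  = sgn (2 + k)
  e′ = sgn (suc k)
  c₁ = num (N C suc (m + k))
  c₂ = num (N C (2 + (m + k)))
  c₃ = num (N C (3 + (m + k)))
  collect : ∀ e a b c →
    (-P (-P e)) *P c +P -P (2P *P ((-P e) *P b)) +P e *P a ≋ -P ((-P e) *P (a +P 2P *P b +P c))
  collect = solve-∀ polyACR

-- Self-adjointness moves `δ²` from `f` onto the weights, raising their `m`. The slack `j` pads the
-- sum with zero terms: the weights must vanish at the upper end, so the recursive call is made with
-- `suc j`.
δ²^-signedCentral : ∀ m j f → δ²^ m f 0 ≋ sgn m *P Σ< (suc (m + j)) (λ k → signedCentral m k *P f k)
δ²^-signedCentral zero j f = begin
  f 0                                                        ≈⟨ expand (f 0) ⟩
  1P *P (1P *P 1P *P f 0 +P [])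
    ≈⟨ *P-congˡ 1P (+P-congˡ (1P *P 1P *P f 0) (≋-sym
         (Σ<-0 j λ k → *P-cong {q = f (suc k)} (signedCentral-vanishes {0} {suc k} (s≤s z≤n)) ≋-refl))) ⟩
  1P *P (1P *P 1P *P f 0 +P Σ< j (λ k → signedCentral 0 (suc k) *P f (suc k))) ∎
  where
  expand : ∀ p → p ≋ 1P *P (1P *P 1P *P p +P [])
  expand = solve-∀ polyACR
δ²^-signedCentral (suc m) j f = begin
  δ²^ m (δ² f) 0                                             ≈⟨ δ²^-signedCentral m (suc j) (δ² f) ⟩
  sgn m *P Σ< (suc (m + suc j)) (λ k → signedCentral m k *P δ² f k)
    ≡⟨ ≡.cong (λ n → sgn m *P Σ< (suc n) (λ k → signedCentral m k *P δ² f k)) (ℕ.+-suc m j) ⟩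
  sgn m *P Σ< (2 + n) (λ k → signedCentral m k *P δ² f k)
    ≈⟨ *P-congˡ (sgn m) (≋-sym (δ²-selfAdjoint (suc n) (signedCentral m) f
         (signedCentral-vanishes (s≤s (ℕ.m≤m+n m j))) (signedCentral-vanishes (s≤s (ℕ.m≤n⇒m≤1+n (ℕ.m≤m+n m j)))))) ⟩
  sgn m *P Σ< (2 + n) (λ k → δ² (signedCentral m) k *P f k)
    ≈⟨ *P-congˡ (sgn m) (Σ<-cong (2 + n) λ k _ → ≋-trans (*P-cong {q = f k} (δ²-signedCentral m k) ≋-refl) (neg-* (signedCentral (suc m) k) (f k))) ⟩
  sgn m *P Σ< (2 + n) (λ k → (-P 1P) *P (signedCentral (suc m) k *P f k))
    ≈⟨ *P-congˡ (sgn m) (Σ<-scale (2 + n) (-P 1P) (λ k → signedCentral (suc m) k *P f k)) ⟩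
  sgn m *P ((-P 1P) *P Σ< (2 + n) (λ k → signedCentral (suc m) k *P f k))
    ≈⟨ neg-out (sgn m) (Σ< (2 + n) (λ k → signedCentral (suc m) k *P f k)) ⟩
  sgn (suc m) *P Σ< (2 + n) (λ k → signedCentral (suc m) k *P f k) ∎
  where
  n : ℕ
  n = m + j
  neg-* : ∀ p q → (-P p) *P q ≋ (-P 1P) *P (p *P q)
  neg-* = solve-∀ polyACR
  neg-out : ∀ p q → p *P ((-P 1P) *P q) ≋ (-P p) *P q
  neg-out = solve-∀ polyACR

-- Cancellation

Regular : Poly → Set
Regular c = ∀ {p} → c *P p ≋ [] → p ≋ []

regular-cancel : ∀ {c p q} → Regular c → c *P p ≋ c *P q → p ≋ q
regular-cancel {c} {p} {q} reg e = ≋-trans (≋-sym (+P-restore q p))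
  (+P-congʳ q (reg (≋-trans (*P-distribˡ- c p q) (≋-trans (+P-congʳ (-P (c *P q)) e) (-P-inverseʳ (c *P q))))))
  where
  +P-restore : ∀ q p → (p +P -P q) +P q ≋ p
  +P-restore = solve-∀ polyACR
  *P-distribˡ- : ∀ c p q → c *P (p +P -P q) ≋ c *P p +P -P (c *P q)
  *P-distribˡ- = solve-∀ polyACR

regular-∣-cancel : ∀ {c d p} → Regular c → c *P d ∣ c *P p → d ∣ p
regular-∣-cancel {c} {d} {p} reg (q , e) = q , regular-cancel {c} reg (≋-trans (swap c q d) e)
  where
  swap : ∀ c q d → c *P (q *P d) ≋ q *P (c *P d)
  swap = solve-∀ polyACR

regular-powP : ∀ {c} → Regular c → ∀ n → Regular (powP c n)
regular-powP     reg zero    {p} e = ≋-trans (≋-sym (*P-identityˡ p)) e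
regular-powP {c} reg (suc n) {p} e = regular-powP {c} reg n (reg (≋-trans (≋-sym (*P-assoc c (powP c n) p)) e))

-- Coprimality is encoded by Euclid's lemma, since Bézout fails in ℤ[x]: neither 2 nor x generates
-- the unit ideal together with x²+4.
CoprimeTo : Poly → Poly → Set
CoprimeTo d c = ∀ {q} → c ∣ d *P q → c ∣ q

coprime-powP : ∀ {c d} → CoprimeTo d c → ∀ n → CoprimeTo (powP d n) c
coprime-powP         cop zero    {q} h = ∣ʳ-respʳ-≈ (*P-identityˡ q) h
coprime-powP {c} {d} cop (suc n) {q} h = coprime-powP {c} {d} cop n (cop (∣ʳ-respʳ-≈ (*P-assoc d (powP d n) q) h))

-- If q d = c p, then c divides d q, hence q; writing q = r c and cancelling c leaves r d = p.
coprime-∣-cancel : ∀ {c d p} → Regular c → CoprimeTo d c → d ∣ c *P p → d ∣ p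
coprime-∣-cancel {c} {d} {p} reg cop (q , e)
  with r , f ← cop {q} (p , ≋-trans (*P-comm p c) (≋-trans (≋-sym e) (*P-comm q d)))
  = r , regular-cancel {c} reg (≋-trans (swap c r d) (≋-trans (*P-cong f ≋-refl) e))
  where
  swap : ∀ c r d → c *P (r *P d) ≋ (r *P c) *P d
  swap = solve-∀ polyACR

-- Regularity and coprimality for x²+4, x and 2

X-*P : ∀ p → X *P p ≋ + 0 ∷ p
X-*P p = ≋-trans (0∷-*P 1P p) (∷-cong ≡.refl (*P-identityˡ p))

x²+4-*P : ∀ p → x²+4 *P p ≋ (+ 0 ∷ + 0 ∷ p) +P scaleP (+ 4) p
x²+4-*P p = ≋-trans (expand p)
  (+P-cong (≋-trans (X-*P (X *P p)) (∷-cong ≡.refl (X-*P p))) (constP-* (+ 4) p))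
  where
  expand : ∀ p → x²+4 *P p ≋ X *P (X *P p) +P constP (+ 4) *P p
  expand = solve-∀ polyACR

coeff-x²+4-*P : ∀ p i → coeff (x²+4 *P p) i ≡ coeff (+ 0 ∷ + 0 ∷ p) i ℤ.+ + 4 ℤ.* coeff p i
coeff-x²+4-*P p i = ≡.trans (coeffs (x²+4-*P p) i)
  (≡.trans (coeff-+P (+ 0 ∷ + 0 ∷ p) (scaleP (+ 4) p) i)
    (≡.cong (λ c → coeff (+ 0 ∷ + 0 ∷ p) i ℤ.+ c) (coeff-scaleP (+ 4) p i)))

4a≡0⇒a≡0 : ∀ {a} → + 0 ℤ.+ + 4 ℤ.* a ≡ + 0 → a ≡ + 0
4a≡0⇒a≡0 {a} e = ℤ.*-cancelˡ-≡ (+ 4) a (+ 0) (≡.trans (≡.sym (ℤ.+-identityˡ _)) e)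

-- Upward induction on the coefficients: once coefficient i of `p` vanishes, coefficient i+2 of the
-- product is 4 times that of `p`.
regular-x²+4 : Regular x²+4
regular-x²+4 {p} e = coeffwise vanish
  where
  vanish : ∀ i → coeff p i ≡ + 0
  vanish zero          = 4a≡0⇒a≡0 (≡.trans (≡.sym (coeff-x²+4-*P p 0)) (coeffs e 0))
  vanish (suc zero)    = 4a≡0⇒a≡0 (≡.trans (≡.sym (coeff-x²+4-*P p 1)) (coeffs e 1))
  vanish (suc (suc i)) = 4a≡0⇒a≡0 (≡.trans (≡.cong (λ c → c ℤ.+ + 4 ℤ.* coeff p (2 + i)) (≡.sym (vanish i)))
    (≡.trans (≡.sym (coeff-x²+4-*P p (2 + i))) (coeffs e (2 + i))))

regular-X : Regular X
regular-X {p} e = coeffwise λ i → coeffs (≋-trans (≋-sym (X-*P p)) e) (suc i)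

regular-2 : Regular 2P
regular-2 {p} e = coeffwise λ i → ℤ.*-cancelˡ-≡ (+ 2) (coeff p i) (+ 0)
  (≡.trans (≡.sym (coeff-scaleP (+ 2) p i)) (coeffs (≋-trans (≋-sym (constP-* (+ 2) p)) e) i))

coeff-drop1 : ∀ p i → coeff (drop 1 p) i ≡ coeff p (suc i)
coeff-drop1 []      i = ≡.refl
coeff-drop1 (a ∷ p) i = ≡.refl

coeff-drop2 : ∀ p i → coeff (drop 2 p) i ≡ coeff p (2 + i)
coeff-drop2 []          i = ≡.refl
coeff-drop2 (a ∷ [])    i = ≡.refl
coeff-drop2 (a ∷ b ∷ p) i = ≡.refl

-- Divisibility by x means a zero constant term, and that of (x²+4) q is 4 times that of q.
coprime-X : CoprimeTo x²+4 X
coprime-X {q} (r , e) = drop 1 q , ≋-trans (*P-comm (drop 1 q) X) (≋-trans (X-*P (drop 1 q)) (coeffwise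
  λ { zero → ≡.sym q₀≡0 ; (suc i) → coeff-drop1 q i }))
  where
  q₀≡0 : coeff q 0 ≡ + 0
  q₀≡0 = 4a≡0⇒a≡0 (≡.trans (≡.sym (coeff-x²+4-*P q 0))
    (≡.trans (≡.sym (coeffs e 0)) (coeffs (≋-trans (*P-comm r X) (X-*P r)) 0)))

-- Modulo 2, multiplication by x²+4 is a shift by two places.
coprime-2 : CoprimeTo x²+4 2P
coprime-2 {q} (r , e) = h , ≋-trans (*P-comm h 2P) (≋-trans (constP-* (+ 2) h) (coeffwise λ i →
  ≡.trans (coeff-scaleP (+ 2) h i) (≡.trans (≡.cong (+ 2 ℤ.*_) (coeff-h i))
  (≡.trans (distrib (coeff r (2 + i)) (coeff q (2 + i)))
  (≡.trans (≡.cong (λ c → c ℤ.+ ℤ.- (+ 4 ℤ.* coeff q (2 + i))) (2r≡ i)) (cancel (coeff q i) (+ 4 ℤ.* coeff q (2 + i))))))))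
  where
  h : Poly
  -- Comparing coefficients of 2r = (x²+4) q at i+2 gives q_i = 2 (r_{i+2} - 2 q_{i+2}), so `h` is
  -- q/2.
  h = drop 2 r +P scaleP (ℤ.- + 2) (drop 2 q)
  coeff-h : ∀ i → coeff h i ≡ coeff r (2 + i) ℤ.+ (ℤ.- + 2) ℤ.* coeff q (2 + i)
  coeff-h i = ≡.trans (coeff-+P (drop 2 r) (scaleP (ℤ.- + 2) (drop 2 q)) i)
    (≡.cong₂ ℤ._+_ (coeff-drop2 r i) (≡.trans (coeff-scaleP (ℤ.- + 2) (drop 2 q) i) (≡.cong ((ℤ.- + 2) ℤ.*_) (coeff-drop2 q i))))
  2r≡ : ∀ i → + 2 ℤ.* coeff r (2 + i) ≡ coeff q i ℤ.+ + 4 ℤ.* coeff q (2 + i)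
  2r≡ i = ≡.trans (≡.sym (coeff-scaleP (+ 2) r (2 + i)))
    (≡.trans (coeffs (≋-trans (≋-sym (constP-* (+ 2) r)) (≋-trans (*P-comm 2P r) e)) (2 + i)) (coeff-x²+4-*P q (2 + i)))
  distrib : ∀ a b → + 2 ℤ.* (a ℤ.+ (ℤ.- + 2) ℤ.* b) ≡ + 2 ℤ.* a ℤ.+ ℤ.- (+ 4 ℤ.* b)
  distrib = ℤ-Solver.solve-∀
  cancel : ∀ a b → (a ℤ.+ b) ℤ.+ ℤ.- b ≡ a
  cancel = ℤ-Solver.solve-∀

-- The vanishing of the weighted sum of the truncated inverses of L_{2k+1}

powP-+ : ∀ p m n → powP p (m + n) ≋ powP p m *P powP p n
powP-+ p zero    n = ≋-sym (*P-identityˡ (powP p n))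
powP-+ p (suc m) n = ≋-trans (*P-congˡ p (powP-+ p m n)) (≋-sym (*P-assoc p (powP p m) (powP p n)))

y^⌈1+2m/2⌉ : ∀ m → y^⌈ 1 + m * 2 /2⌉ ≋ powP x²+4 (suc m)
y^⌈1+2m/2⌉ zero    = *P-comm 1P x²+4
y^⌈1+2m/2⌉ (suc m) = *P-congˡ x²+4 (y^⌈1+2m/2⌉ m)

-- A stand-in for x R₂ modulo (x²+4)^(m-s): `geometric` replaces 1/N_k, and the sign in
-- `signedCentral` comes from 1/L_{2k+1} = (-1)^k / (x N_k), where N_k is `reducedLucas k`.
weightedSum : ℕ → ℕ → Poly
weightedSum m s = Σ< (suc m) λ k →
  signedCentral m k *P (num (oddBinomial s k) *P geometric (m ∸ s) (reducedLucas k))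

-- Tameness of `product` gives m+1 factors x²+4 in its central difference of order 2m+1; cancelling
-- the s+1 factors put into `scaledKernel` leaves m - s.
x²+4^∣2weightedSum : ∀ {m s} → s < m → powP x²+4 (m ∸ s) ∣ 2P *P weightedSum m s
x²+4^∣2weightedSum {m} {s} s<m = regular-∣-cancel {Y} (regular-powP {x²+4} regular-x²+4 (suc s))
  (∣ʳ-respˡ-≈ (≋-trans (y^⌈1+2m/2⌉ m) split-power)
    -- The extra `sgn m` squares away the one from `δ²^-signedCentral`.
    (∣ʳ-respʳ-≈ total (x∣ʳy⇒x∣ʳzy (sgn m) (∣ʳ-respʳ-≈ (Δ^-cong (1 + m * 2) product-odd -[1+ m ])
      (≡.subst (λ n → y^⌈ n /2⌉ ∣ Δ^ (1 + m * 2) product -[1+ m ]) (ℕ.+-identityʳ (1 + m * 2))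
        (tame-product (1 + m * 2) -[1+ m ]))))))
  where
  J : ℕ
  J = m ∸ s
  Y : Poly
  Y = powP x²+4 (suc s)
  product : ℤ → Poly
  product z = scaledKernel s z *P geometric J (evenExt reducedLucas z)
  g f : ℕ → Poly
  g k = num (oddBinomial s k) *P geometric J (reducedLucas k)
  f k = Y *P num (oddBinomial s k) *P geometric J (reducedLucas k)

  tame-product : Tame 0 product
  tame-product = tame-*P {0} {0} {scaledKernel s} {geometric J ∘ evenExt reducedLucas}
    (tame-scaledKernel s) (tame-geometric J {evenExt reducedLucas} tame-reducedLucas)

  product-odd : ∀ z → product z ≋ oddExt f z
  product-odd (+ k)    = ≋-refl
  product-odd -[1+ k ] = neg-inner Y (num (oddBinomial s k)) (geometric J (reducedLucas k))
    where
    neg-inner : ∀ a b c → a *P (-P b) *P c ≋ -P (a *P b *P c)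
    neg-inner = solve-∀ polyACR

  split-power : powP x²+4 (suc m) ≋ Y *P powP x²+4 J
  split-power = ≋-trans
    (≋-reflexive (≡.cong (λ n → powP x²+4 (suc n)) (≡.sym (ℕ.m+[n∸m]≡n (ℕ.<⇒≤ s<m)))))
    (powP-+ x²+4 (suc s) J)

  total : sgn m *P Δ^ (1 + m * 2) (oddExt f) -[1+ m ] ≋ Y *P (2P *P weightedSum m s)
  total = begin
    sgn m *P Δ^ (1 + m * 2) (oddExt f) -[1+ m ]   ≈⟨ *P-congˡ (sgn m) (Δ-oddExt-centre m f) ⟩
    sgn m *P (2P *P δ²^ m f 0)
      ≈⟨ *P-congˡ (sgn m) (*P-congˡ 2P (≋-trans (δ²^-signedCentral m 0 f)
           (≋-reflexive (≡.cong (λ n → sgn m *P Σ< (suc n) (λ k → signedCentral m k *P f k)) (ℕ.+-identityʳ m))))) ⟩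
    sgn m *P (2P *P (sgn m *P Σ< (suc m) (λ k → signedCentral m k *P f k)))
      ≈⟨ signs (sgn m) (Σ< (suc m) (λ k → signedCentral m k *P f k)) ⟩
    (sgn m *P sgn m) *P (2P *P Σ< (suc m) (λ k → signedCentral m k *P f k))
      ≈⟨ *P-cong (sgn² m) (*P-congˡ 2P (≋-trans
           (Σ<-cong (suc m) λ k _ → pull (signedCentral m k) Y (num (oddBinomial s k)) (geometric J (reducedLucas k)))
           (Σ<-scale (suc m) Y (λ k → signedCentral m k *P g k)))) ⟩
    1P *P (2P *P (Y *P weightedSum m s))          ≈⟨ rearrange Y (weightedSum m s) ⟩
    Y *P (2P *P weightedSum m s)                  ∎
    where
    signs : ∀ e p → e *P (2P *P (e *P p)) ≋ (e *P e) *P (2P *P p)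
    signs = solve-∀ polyACR
    pull : ∀ t y b c → t *P (y *P b *P c) ≋ y *P (t *P (b *P c))
    pull = solve-∀ polyACR
    rearrange : ∀ y p → 1P *P (2P *P (y *P p)) ≋ y *P (2P *P p)
    rearrange = solve-∀ polyACR

-- Passing from the truncated inverses to the products with a factor omitted

-- Uniqueness makes the filter remove exactly one factor: at `here` it leaves the whole tail.
prodP-without : ∀ (g : ℕ → Poly) {k xs} → Unique xs → k ∈ xs →
  prodP (map g xs) ≋ prodP (map g (filter (λ j → ¬? (j ≟ k)) xs)) *P g k
prodP-without g {k} {k ∷ xs} (k∉xs ∷ _) (here ≡.refl) = begin
  g k *P prodP (map g xs)                         ≈⟨ *P-comm (g k) (prodP (map g xs)) ⟩
  prodP (map g xs) *P g k
    ≡⟨ ≡.cong (λ ys → prodP (map g ys) *P g k) (≡.trans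
         (≡.sym (filter-all ≢k? (All.map ≡.≢-sym k∉xs))) (≡.sym (filter-reject ≢k? λ k≢k → k≢k ≡.refl))) ⟩
  prodP (map g (filter ≢k? (k ∷ xs))) *P g k      ∎
  where
  ≢k? = λ j → ¬? (j ≟ k)
prodP-without g {k} {x ∷ xs} (x∉xs ∷ u) (there k∈xs) = begin
  g x *P prodP (map g xs)                            ≈⟨ *P-congˡ (g x) (prodP-without g u k∈xs) ⟩
  g x *P (prodP (map g (filter ≢k? xs)) *P g k)      ≈⟨ ≋-sym (*P-assoc (g x) (prodP (map g (filter ≢k? xs))) (g k)) ⟩
  g x *P prodP (map g (filter ≢k? xs)) *P g k
    ≡⟨ ≡.cong (λ ys → prodP (map g ys) *P g k) (≡.sym (filter-accept ≢k? (All.lookup x∉xs k∈xs))) ⟩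
  prodP (map g (filter ≢k? (x ∷ xs))) *P g k         ∎
  where
  ≢k? = λ j → ¬? (j ≟ k)

range-unique : ∀ s m → Unique (range s m)
range-unique s m = map⁺ (ℕ.+-cancelˡ-≡ s _ _) (upTo⁺ (suc (m ∸ s)))

lucas-2k+1 : ∀ k → lucas (suc (2 * k)) ≋ sgn k *P (X *P reducedLucas k)
lucas-2k+1 k = ≋-trans (≋-reflexive (≡.cong (λ n → lucas (suc n)) (ℕ.*-comm 2 k))) (lucas≋reducedLucas k)

-- (2s+1)⁻¹ times the k-th coefficient of scaledR
coefficient : ℕ → ℕ → ℕ → ℕ
coefficient m s k = ((1 + 2 * m) C (m ∸ k)) * oddBinomial s k

integralR : ℕ → ℕ → Poly
integralR m s = Σ< (suc (m ∸ s)) λ i → num (coefficient m s (s + i)) *P R₁-without m s (s + i)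

-- The factor 2s+1 comes out of each coefficient separately, by `oddBinomial-scaled`; hence R itself
-- has integer coefficients.
scaledR≋integralR : ∀ m s → scaledR m s ≋ scaleP (+ (1 + 2 * s)) (integralR m s)
scaledR≋integralR m s = begin
  sumP (map g (map (λ i → s + i) (upTo n)))         ≡⟨ ≡.cong sumP (≡.sym (map-∘ (upTo n))) ⟩
  sumP (map (λ i → g (s + i)) (upTo n))             ≡⟨ ≡.cong sumP (map-upTo (λ i → g (s + i)) n) ⟩
  Σ< n (λ i → g (s + i))                            ≈⟨ Σ<-cong n (λ i _ → summand (s + i)) ⟩
  Σ< n (λ i → num (1 + 2 * s) *P (num (coefficient m s (s + i)) *P W (s + i)))
    ≈⟨ Σ<-scale n (num (1 + 2 * s)) (λ i → num (coefficient m s (s + i)) *P W (s + i)) ⟩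
  num (1 + 2 * s) *P integralR m s                  ≈⟨ constP-* (+ (1 + 2 * s)) (integralR m s) ⟩
  scaleP (+ (1 + 2 * s)) (integralR m s)            ∎
  where
  n : ℕ
  n = suc (m ∸ s)
  W g : ℕ → Poly
  W = R₁-without m s
  c : ℕ → ℕ
  c k = (1 + 2 * k) * ((1 + 2 * m) C (m ∸ k)) * ((k + s) C (2 * s))
  g k = scaleP (+ c k) (W k)
  factor : ∀ k → c k ≡ (1 + 2 * s) * coefficient m s k
  factor k = ≡.trans (≡.cong (λ i → (1 + 2 * k) * b * ((k + s) C i)) (ℕ.*-comm 2 s))
    (≡.trans (pull k b ((k + s) C (s * 2)))
    (≡.trans (≡.cong (b *_) (≡.sym (oddBinomial-scaled s k))) (push s b (oddBinomial s k))))
    where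
    b : ℕ
    b = (1 + 2 * m) C (m ∸ k)
    pull : ∀ k b c → (1 + 2 * k) * b * c ≡ b * ((1 + k * 2) * c)
    pull = ℕ-Solver.solve-∀
    push : ∀ s b c → b * ((1 + s * 2) * c) ≡ (1 + 2 * s) * (b * c)
    push = ℕ-Solver.solve-∀
  summand : ∀ k → g k ≋ num (1 + 2 * s) *P (num (coefficient m s k) *P W k)
  summand k = begin
    scaleP (+ c k) (W k)                                  ≈⟨ ≋-sym (constP-* (+ c k) (W k)) ⟩
    num (c k) *P W k                                      ≡⟨ ≡.cong (λ a → num a *P W k) (factor k) ⟩
    num ((1 + 2 * s) * coefficient m s k) *P W k          ≈⟨ *P-cong {q = W k} (num-* (1 + 2 * s) (coefficient m s k)) ≋-refl ⟩
    num (1 + 2 * s) *P num (coefficient m s k) *P W k     ≈⟨ *P-assoc (num (1 + 2 * s)) (num (coefficient m s k)) (W k) ⟩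
    num (1 + 2 * s) *P (num (coefficient m s k) *P W k)   ∎

weightedSum-range : ∀ {m s} → s < m → weightedSum m s ≋ Σ< (suc (m ∸ s)) λ i →
  signedCentral m (s + i) *P (num (oddBinomial s (s + i)) *P geometric (m ∸ s) (reducedLucas (s + i)))
weightedSum-range {m} {s} s<m = ≋-trans
  (≋-reflexive (≡.cong (λ n → Σ< n t) (≡.sym (≡.trans (ℕ.+-suc s (m ∸ s)) (≡.cong suc (ℕ.m+[n∸m]≡n (ℕ.<⇒≤ s<m)))))))
  (Σ<-drop s (suc (m ∸ s)) {t} λ k k<s → ≋-trans
    (*P-congˡ (signedCentral m k) (*P-cong {q = geometric (m ∸ s) (reducedLucas k)} (num-0 (k<s⇒oddBinomial≡0 k<s)) ≋-refl))
    (*P-zeroʳ (signedCentral m k)))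
  where
  t : ℕ → Poly
  t k = signedCentral m k *P (num (oddBinomial s k) *P geometric (m ∸ s) (reducedLucas k))

C-reflect : ∀ {m k} → k ≤ m → (1 + 2 * m) C (m ∸ k) ≡ (1 + m * 2) C suc (m + k)
C-reflect {m} {k} k≤m = ≡.trans (nCk≡nC[n∸k] (ℕ.≤-trans (ℕ.m∸n≤m m k) (ℕ.m≤n⇒m≤1+n (ℕ.m≤m+n m _))))
  (≡.cong₂ _C_ (≡.cong suc (ℕ.*-comm 2 m)) (≡.trans (≡.cong (_∸ (m ∸ k)) split) (ℕ.m+n∸m≡n (m ∸ k) (suc (m + k)))))
  where
  rearrange : ∀ a k → 1 + 2 * (a + k) ≡ a + suc ((a + k) + k)
  rearrange = ℕ-Solver.solve-∀
  split : 1 + 2 * m ≡ (m ∸ k) + suc (m + k)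
  split = ≡.subst (λ n → 1 + 2 * n ≡ (m ∸ k) + suc (n + k)) (ℕ.m∸n+n≡m k≤m) (rearrange (m ∸ k) k)

-- X · R₁/L_{2k+1} ≡ (-1)^k R₁ · (truncated inverse of the reduced L_{2k+1}).
x²+4^∣X*integralR-weightedSum : ∀ {m s} → s < m →
  powP x²+4 (m ∸ s) ∣ X *P integralR m s +P -P (R₁ m s *P weightedSum m s)
x²+4^∣X*integralR-weightedSum {m} {s} s<m = ∣ʳ-respʳ-≈
  (+P-cong (Σ<-scale n X p) (-‿cong (≋-trans (Σ<-scale n (R₁ m s) q) (*P-congˡ (R₁ m s) (≋-sym (weightedSum-range s<m))))))
  (∣-Σ<-difference n {λ i → X *P p i} {λ i → R₁ m s *P q i} λ i i<n → ∣ʳ-respʳ-≈ (summand i i<n)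
    (x∣ʳy⇒x∣ʳzy (X *P num (coefficient m s (s + i)) *P W (s + i))
      (geometric-inverse {x²+4} {reducedLucas (s + i)} (x²+4∣1-reducedLucas (s + i)) J)))
  where
  J n : ℕ
  J = m ∸ s
  n = suc J
  W p q : ℕ → Poly
  W = R₁-without m s
  p i = num (coefficient m s (s + i)) *P W (s + i)
  q i = signedCentral m (s + i) *P (num (oddBinomial s (s + i)) *P geometric J (reducedLucas (s + i)))

  summand : ∀ i → i < n →
    X *P num (coefficient m s (s + i)) *P W (s + i) *P (1P +P -P (reducedLucas (s + i) *P geometric J (reducedLucas (s + i))))
    ≋ X *P p i +P -P (R₁ m s *P q i)
  summand i (s≤s i≤J) = begin
    X *P num (coefficient m s k) *P W k *P (1P +P -P (N *P G))
      ≈⟨ expand X (num (coefficient m s k)) (W k) N G ⟩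
    X *P p i +P -P (1P *P (X *P num (coefficient m s k) *P W k *P N *P G))
      -- The 1 becomes two copies of (-1)^k: one completes L_{2k+1}, and with it R₁, the other
      -- completes `signedCentral`.
      ≈⟨ +P-congˡ (X *P p i) (-‿cong (*P-cong (≋-sym (sgn² k))
           (*P-cong {q = G} (*P-cong {q = N} (*P-cong {q = W k} (*P-congˡ X split-coefficient) ≋-refl) ≋-refl) ≋-refl))) ⟩
    X *P p i +P -P (sgn k *P sgn k *P (X *P (a *P b) *P W k *P N *P G))
      ≈⟨ +P-congˡ (X *P p i) (-‿cong (rearrange X (sgn k) a b (W k) N G)) ⟩
    X *P p i +P -P (W k *P (sgn k *P (X *P N)) *P (sgn k *P a *P (b *P G)))
      ≈⟨ +P-congˡ (X *P p i) (-‿cong (*P-cong {q = q i} (≋-sym R₁-split) ≋-refl)) ⟩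
    X *P p i +P -P (R₁ m s *P q i) ∎
    where
    k : ℕ
    k = s + i
    N G a b : Poly
    N = reducedLucas k
    G = geometric J N
    a = num ((1 + m * 2) C suc (m + k))
    b = num (oddBinomial s k)
    k≤m : k ≤ m
    k≤m = ℕ.≤-trans (ℕ.+-monoʳ-≤ s i≤J) (ℕ.≤-reflexive (ℕ.m+[n∸m]≡n (ℕ.<⇒≤ s<m)))
    split-coefficient : num (coefficient m s k) ≋ a *P b
    split-coefficient = ≋-trans (≋-reflexive (≡.cong (λ c → num (c * oddBinomial s k)) (C-reflect k≤m)))
      (num-* ((1 + m * 2) C suc (m + k)) (oddBinomial s k))
    R₁-split : R₁ m s ≋ W k *P (sgn k *P (X *P N))
    R₁-split = ≋-trans
      (prodP-without (λ j → lucas (suc (2 * j))) (range-unique s m) (∈-map⁺ (λ i → s + i) (∈-upTo⁺ (s≤s i≤J))))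
      (*P-congˡ (W k) (lucas-2k+1 k))
    expand : ∀ x c w n g → x *P c *P w *P (1P +P -P (n *P g)) ≋ x *P (c *P w) +P -P (1P *P (x *P c *P w *P n *P g))
    expand = solve-∀ polyACR
    rearrange : ∀ x e a b w n g → e *P e *P (x *P (a *P b) *P w *P n *P g) ≋ w *P (e *P (x *P n)) *P (e *P a *P (b *P g))
    rearrange = solve-∀ polyACR

-- With I = `integralR m s` and S = `weightedSum m s`, 2xI = 2(xI - R₁S) + R₁(2S). Both summands are
-- divisible, and the factors 2 and x, coprime to x²+4, cancel.
x²+4^∣integralR : ∀ {m s} → s < m → powP x²+4 (m ∸ s) ∣ integralR m s
x²+4^∣integralR {m} {s} s<m =
  coprime-∣-cancel {X} {D} regular-X (coprime-powP {X} {x²+4} coprime-X (m ∸ s))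
  (coprime-∣-cancel {2P} {D} regular-2 (coprime-powP {2P} {x²+4} coprime-2 (m ∸ s))
  (∣ʳ-respʳ-≈ (collect (X *P integralR m s) (R₁ m s) (weightedSum m s))
    (∣-+P (x∣ʳy⇒x∣ʳzy 2P (x²+4^∣X*integralR-weightedSum s<m)) (x∣ʳy⇒x∣ʳzy (R₁ m s) (x²+4^∣2weightedSum s<m)))))
  where
  D : Poly
  D = powP x²+4 (m ∸ s)
  collect : ∀ p u q → 2P *P (p +P -P (u *P q)) +P u *P (2P *P q) ≋ 2P *P p
  collect = solve-∀ polyACR

theorem2p2 : (m s : ℕ) → s < m →
    Σ Poly (λ Q → scaleP (+ (1 + 2 * s)) (powP x²+4 (m ∸ s) *P Q) ≈P scaledR m s)
theorem2p2 m s s<m = quotient , coeffs (begin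
  scaleP (+ (1 + 2 * s)) (powP x²+4 (m ∸ s) *P quotient)   ≈⟨ scaleP-cong (+ (1 + 2 * s)) (*P-comm (powP x²+4 (m ∸ s)) quotient) ⟩
  scaleP (+ (1 + 2 * s)) (quotient *P powP x²+4 (m ∸ s))   ≈⟨ scaleP-cong (+ (1 + 2 * s)) equality ⟩
  scaleP (+ (1 + 2 * s)) (integralR m s)                   ≈⟨ scaledR≋integralR m s ⟨
  scaledR m s                                              ∎)
  where
  open _∣ʳ_ (x²+4^∣integralR s<m)
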